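{- Let $n\equiv 1\pmod 4$. Let $I_1,I_2\subseteq\{0,1,\dots,(n-1)/2\}$ be such that $\{2i,2i+1\}\cap\{j,n-j\}=\emptyset$ for all $i\in I_1$ and $j\in I_2$, and let $$D=\bigcup_{i\in I_1}\{2i,2i+1\}\cup\bigcup_{j\in I_2}\{j,n-j\}.$$ Then the hypercube $Q_n$ admits a $D$-magic labeling.
   Context: The hypercube $Q_n$ has vertex set $\mathbb{F}_2^n$, two vertices adjacent iff they differ in exactly one coordinate; $d(x,y)$ is the graph distance (the Hamming distance). For a set of distances $D$ and a vertex $x$ of a graph $G$, $N_D(x)=\{y\in V(G): d(x,y)\in D\}$. For a graph $G$ of order $N$, a $D$-magic labeling is a bijection $f:V(G)\to\{1,\dots,N\}$ for which there exists a constant $k$ with $\sum_{y\in N_D(x)}f(y)=k$ for every vertex $x$. -}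

module Defs where

open import Data.Bool.Base using (Bool; true; false)
open import Data.Fin.Base using (Fin; zero; suc; toℕ)
open import Data.Fin.Properties using (*↔×)
open import Data.Fin.Subset using (Subset) renaming (_∈_ to _∈ₛ_)
open import Data.List.Base using (List; map; sum)
open import Data.List.Membership.Propositional using () renaming (_∈_ to _∈ₗ_)
open import Data.List.Relation.Unary.Unique.Propositional using (Unique)
open import Data.Nat.Base using (ℕ; zero; suc; _+_; _*_; _∸_; _^_; _≤_; _/_)
open import Data.Product.Base using (Σ-syntax; ∃-syntax; _×_; _,_)
open import Data.Product using (∃!)
open import Data.Product.Function.NonDependent.Propositional using (_×-↔_)
open import Data.Vec.Base using (Vec; []; _∷_; lookup)
open import Function.Base using (_∘_)
open import Function.Bundles using (_↔_; _⤖_; _⇔_; mk↔ₛ′; module Bijection)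
open import Function.Construct.Composition using (_↔-∘_)
open import Function.Construct.Symmetry using (↔-sym)
open import Level using (0ℓ)
open import Relation.Binary.Core using (Rel)
open import Relation.Binary.Definitions using (Symmetric)
open import Relation.Binary.PropositionalEquality using (_≡_; _≢_; refl; sym)
open import Relation.Nullary.Negation using (¬_)
open import Relation.Unary using (Pred; _∈_; _∪_; ｛_｝)

record FiniteGraph : Set₁ where
  field
    Vertex   : Set
    order    : ℕ
    finite   : Vertex ↔ Fin order
    Adj      : Rel Vertex 0ℓ
    adj-sym  : Symmetric Adj
    loopless : ∀ x → ¬ Adj x x

module _ (G : FiniteGraph) where
  open FiniteGraph G

  data Walk : Vertex → Vertex → ℕ → Set where
    stop : ∀ {x} → Walk x x 0
    step : ∀ {x y z ℓ} → Adj x y → Walk y z ℓ → Walk x z (suc ℓ)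

  -- d(x,y) = d, as a functional relation; no d is related to vertices in
  -- different components.
  IsDistance : Vertex → Vertex → ℕ → Set
  IsDistance x y d = Walk x y d × (∀ ℓ → Walk x y ℓ → d ≤ ℓ)

  Neighbourhood : Pred ℕ 0ℓ → Vertex → Pred Vertex 0ℓ
  Neighbourhood D x y = ∃[ d ] (IsDistance x y d × d ∈ D)

-- Σ_{y ∈ P} f(y) = s.  The list is a duplicate-free enumeration of P, hence
-- determined up to permutation, so s is determined by P and f.
IsSumOver : {A : Set} → Pred A 0ℓ → (A → ℕ) → ℕ → Set
IsSumOver {A} P f s =
  Σ[ ys ∈ List A ] (Unique ys × (∀ y → (y ∈ₗ ys) ⇔ (y ∈ P)) × sum (map f ys) ≡ s)

module _ (G : FiniteGraph) where
  open FiniteGraph G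

  -- {1,…,N} is represented by Fin N through i ↦ 1 + i.
  label : Vertex ⤖ Fin order → Vertex → ℕ
  label f y = suc (toℕ (Bijection.to f y))

  IsMagicLabeling : Pred ℕ 0ℓ → Vertex ⤖ Fin order → Set
  IsMagicLabeling D f = ∃[ k ] (∀ x → IsSumOver (Neighbourhood G D x) (label f) k)

  AdmitsMagicLabeling : Pred ℕ 0ℓ → Set
  AdmitsMagicLabeling D = ∃[ f ] IsMagicLabeling D f

-- Only equality of coordinates matters below; addition in 𝔽₂ would be _xor_.
𝔽₂ : Set
𝔽₂ = Bool

𝔽₂↔Fin2 : 𝔽₂ ↔ Fin 2
𝔽₂↔Fin2 = mk↔ₛ′
  (λ { false → zero ; true → suc zero })
  (λ { zero → false ; (suc zero) → true })
  (λ { zero → refl ; (suc zero) → refl })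
  (λ { false → refl ; true → refl })

𝔽₂^↔Fin : ∀ n → Vec 𝔽₂ n ↔ Fin (2 ^ n)
𝔽₂^↔Fin zero = mk↔ₛ′ (λ _ → zero) (λ _ → []) (λ { zero → refl }) (λ { [] → refl })
𝔽₂^↔Fin (suc n) = ↔-sym *↔× ↔-∘ ((𝔽₂↔Fin2 ×-↔ 𝔽₂^↔Fin n) ↔-∘ uncons↔)
  where
  uncons↔ : Vec 𝔽₂ (suc n) ↔ (𝔽₂ × Vec 𝔽₂ n)
  uncons↔ = mk↔ₛ′ (λ { (b ∷ v) → b , v }) (λ { (b , v) → b ∷ v })
                  (λ { (b , v) → refl }) (λ { (b ∷ v) → refl })

DifferInExactlyOne : ∀ {n} → Rel (Vec 𝔽₂ n) 0ℓ
DifferInExactlyOne x y = ∃! _≡_ (λ i → lookup x i ≢ lookup y i)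

hypercube : ℕ → FiniteGraph
hypercube n = record
  { Vertex   = Vec 𝔽₂ n
  ; order    = 2 ^ n
  ; finite   = 𝔽₂^↔Fin n
  ; Adj      = DifferInExactlyOne
  ; adj-sym  = λ { (i , x≢y , unique) → i , x≢y ∘ sym , λ y≢x → unique (y≢x ∘ sym) }
  ; loopless = λ { x (i , x≢x , _) → x≢x refl }
  }

-- Subsets of {0,…,(n-1)/2}.
IndexSet : ℕ → Set
IndexSet n = Subset (suc ((n ∸ 1) / 2))

consecutivePair : ℕ → Pred ℕ 0ℓ
consecutivePair i = ｛ 2 * i ｝ ∪ ｛ 2 * i + 1 ｝

complementaryPair : ℕ → ℕ → Pred ℕ 0ℓ
complementaryPair n j = ｛ j ｝ ∪ ｛ n ∸ j ｝

distanceSet : ∀ n → IndexSet n → IndexSet n → Pred ℕ 0ℓ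
distanceSet n I₁ I₂ =
    (λ d → ∃[ i ] (i ∈ₛ I₁ × d ∈ consecutivePair (toℕ i)))
  ∪ (λ d → ∃[ j ] (j ∈ₛ I₂ × d ∈ complementaryPair n (toℕ j)))

{-# OPTIONS --safe #-}

-- Write n = 4q + 1.  Label x by 1 plus the number whose binary digits are n
-- linear forms on 𝔽₂ⁿ: the sum of the even-numbered coordinates x₀ + x₂ + ⋯, and
-- the forms obtained from it by exchanging two neighbouring coordinates.  They
-- are linearly independent, and each is a sum of 2q + 1 coordinates.
--
-- The distance set splits into a part D₁ closed under 2i ↔ 2i + 1 and a part D₂
-- closed under d ↔ n − d.  Every form takes both values equally often on the
-- vertices at distance in D₁ from x, since the generating function
-- (1 − z)^(2q+1) (1 + z)^(2q) = (1 − z) (1 − z²)^(2q) has opposite coefficients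
-- at z^(2i) and z^(2i+1); and on those at distance in D₂, since passing to the
-- antipode changes the value of a form with an odd number of terms.  So every
-- digit contributes on average half of its place value to the sum around any x.
module Submission where

open import Defs
open import Algebra.Properties.CommutativeSemigroup using (interchange)
open import Data.Bool.Base using (Bool; true; false; not; _xor_)
open import Data.Bool.Properties using (not-involutive; not-¬; xor-assoc; xor-comm; xor-annihilates-not; not-distribˡ-xor; not-distribʳ-xor; not-injective) renaming (_≟_ to _≟ᵇ_)
open import Data.Fin.Base using (Fin; zero; suc; toℕ; punchOut)
open import Data.Fin.Properties using (any?; injective⇒≤; punchOut-injective; toℕ-combine; toℕ≤pred[n]; 0≢1+n) renaming (_≟_ to _≟ᶠ_; suc-injective to sucᶠ-injective)
open import Data.Fin.Subset using (_∈_)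
open import Data.Fin.Subset.Properties using (_∈?_)
open import Data.List.Base using (List; []; _∷_; _++_; map; filter)
open import Data.List.Membership.Propositional using () renaming (_∈_ to _∈ₗ_)
open import Data.List.Membership.Propositional.Properties using (∈-map⁺; ∈-map⁻; ∈-++⁺ˡ; ∈-++⁺ʳ; ∈-filter⁺; ∈-filter⁻)
open import Data.List.Properties using (map-++; map-∘)
open import Data.List.Relation.Unary.All using ([])
open import Data.List.Relation.Unary.Any using (here)
open import Data.List.Relation.Unary.AllPairs using ([]; _∷_)
open import Data.List.Relation.Unary.Unique.Propositional using (Unique)
open import Data.List.Relation.Unary.Unique.Propositional.Properties using (map⁺; ++⁺; filter⁺)
open import Data.Nat.Base using (ℕ; zero; suc; _+_; _*_; _∸_; _^_; _≤_; _/_; _%_; z≤n; s≤s)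
open import Data.Nat.DivMod using (m≡m%n+[m/n]*n; m/n≤m)
open import Data.Nat.ListAction using (sum)
open import Data.Nat.ListAction.Properties using (sum-++)
open import Data.Nat.Properties using (_≟_; ≤-trans; ≤-antisym; ≤-reflexive; m≤n⇒m≤1+n; m≤n+m; m∸n≤m; 1+n≰n; n≤1+n; +-comm; +-identityʳ; *-comm; *-assoc; *-identityʳ; *-distribˡ-+; *-distribʳ-+; *-cancelˡ-≡; +-commutativeSemigroup; even≢odd; suc-injective; m∸[m∸n]≡n; +-∸-assoc)
open import Data.Nat.Solver using (module +-*-Solver)
open import Data.Product.Base using (_×_; _,_; proj₂; ∃-syntax)
open import Data.Sum.Base using (_⊎_; inj₁; inj₂)
open import Data.Vec.Base as Vec using (Vec; []; _∷_; lookup; tabulate; replicate)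
open import Data.Vec.Properties using (∷-injectiveˡ; ∷-injectiveʳ; lookup∘tabulate)
open import Function.Base using (_∘_)
open import Function.Bundles using (_⤖_; _↔_; _⇔_; mk⇔; mk⤖; module Inverse)
open import Function.Construct.Composition using (_⤖-∘_)
open import Function.Definitions using (Injective; Surjective)
open import Function.Properties.Inverse using (↔⇒⤖)
open import Level using (0ℓ)
open import Relation.Binary.PropositionalEquality using (_≡_; _≢_; _≗_; refl; sym; trans; cong; cong₂; subst; module ≡-Reasoning)
open import Relation.Nullary.Decidable using (Dec; yes; no; does; _×-dec_; _⊎-dec_; map′; does-⇔; decidable-stable)
open import Relation.Nullary.Negation using (¬_; contradiction)
open import Relation.Unary using (Pred; Decidable; Empty; _∩_; _∪_)

private
  variable
    n : ℕ

-- Indicators with values in the natural numbers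

bit : Bool → ℕ
bit false = 0
bit true  = 1

bit-not : ∀ b → bit b + bit (not b) ≡ 1
bit-not false = refl
bit-not true  = refl

𝟙 : {P : Set} → Dec P → ℕ
𝟙 P? = bit (does P?)

𝟙-cong : {P Q : Set} (P? : Dec P) (Q? : Dec Q) → P ⇔ Q → 𝟙 P? ≡ 𝟙 Q?
𝟙-cong P? Q? P⇔Q = cong bit (does-⇔ P⇔Q P? Q?)

𝟙-⊎ : {P Q : Set} (P? : Dec P) (Q? : Dec Q) → (P → ¬ Q) → 𝟙 (P? ⊎-dec Q?) ≡ 𝟙 P? + 𝟙 Q?
𝟙-⊎ (yes p) (yes q) disjoint = contradiction q (disjoint p)
𝟙-⊎ (yes p) (no ¬q) disjoint = refl
𝟙-⊎ (no ¬p) (yes q) disjoint = refl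
𝟙-⊎ (no ¬p) (no ¬q) disjoint = refl

-- Sums over the vertices of the hypercube

∑ : (Vec 𝔽₂ n → ℕ) → ℕ
∑ {zero}  f = f []
∑ {suc n} f = ∑ (f ∘ (false ∷_)) + ∑ (f ∘ (true ∷_))

∑-cong : {f g : Vec 𝔽₂ n → ℕ} → f ≗ g → ∑ f ≡ ∑ g
∑-cong {zero}  f≗g = f≗g []
∑-cong {suc n} f≗g = cong₂ _+_ (∑-cong (f≗g ∘ (false ∷_))) (∑-cong (f≗g ∘ (true ∷_)))

∑-+ : (f g : Vec 𝔽₂ n → ℕ) → ∑ (λ y → f y + g y) ≡ ∑ f + ∑ g
∑-+ {zero}  f g = refl
∑-+ {suc n} f g = trans (cong₂ _+_ (∑-+ f₀ g₀) (∑-+ f₁ g₁))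
  (interchange +-commutativeSemigroup (∑ f₀) (∑ g₀) (∑ f₁) (∑ g₁))
  where
  f₀ = f ∘ (false ∷_)
  f₁ = f ∘ (true ∷_)
  g₀ = g ∘ (false ∷_)
  g₁ = g ∘ (true ∷_)

∑-*ˡ : ∀ c (f : Vec 𝔽₂ n → ℕ) → ∑ (λ y → c * f y) ≡ c * ∑ f
∑-*ˡ {zero}  c f = refl
∑-*ˡ {suc n} c f = trans (cong₂ _+_ (∑-*ˡ c (f ∘ (false ∷_))) (∑-*ˡ c (f ∘ (true ∷_))))
  (sym (*-distribˡ-+ c (∑ (f ∘ (false ∷_))) (∑ (f ∘ (true ∷_)))))

antipode : Vec 𝔽₂ n → Vec 𝔽₂ n
antipode = Vec.map not

∑-antipode : (f : Vec 𝔽₂ n → ℕ) → ∑ (f ∘ antipode) ≡ ∑ f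
∑-antipode {zero}  f = refl
∑-antipode {suc n} f = trans (cong₂ _+_ (∑-antipode (f ∘ (true ∷_))) (∑-antipode (f ∘ (false ∷_))))
  (+-comm (∑ (f ∘ (true ∷_))) (∑ (f ∘ (false ∷_))))

swapAt : Fin n → Vec 𝔽₂ (suc n) → Vec 𝔽₂ (suc n)
swapAt zero    (a ∷ b ∷ v) = b ∷ a ∷ v
swapAt (suc i) (a ∷ v)     = a ∷ swapAt i v

∑-swapAt : (i : Fin n) (f : Vec 𝔽₂ (suc n) → ℕ) → ∑ (f ∘ swapAt i) ≡ ∑ f
∑-swapAt zero    f = interchange +-commutativeSemigroup (∑ (λ v → f (false ∷ false ∷ v))) _ _ _
∑-swapAt (suc i) f = cong₂ _+_ (∑-swapAt i (f ∘ (false ∷_))) (∑-swapAt i (f ∘ (true ∷_)))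

-- From duplicate-free lists to weighted sums over all vertices

vertices : ∀ n → List (Vec 𝔽₂ n)
vertices zero    = [] ∷ []
vertices (suc n) = map (false ∷_) (vertices n) ++ map (true ∷_) (vertices n)

∈-vertices : (y : Vec 𝔽₂ n) → y ∈ₗ vertices n
∈-vertices []          = here refl
∈-vertices (false ∷ y) = ∈-++⁺ˡ (∈-map⁺ (false ∷_) (∈-vertices y))
∈-vertices (true ∷ y)  = ∈-++⁺ʳ _ (∈-map⁺ (true ∷_) (∈-vertices y))

vertices-unique : ∀ n → Unique (vertices n)
vertices-unique zero    = [] ∷ []
vertices-unique (suc n) =
  ++⁺ (map⁺ ∷-injectiveʳ (vertices-unique n)) (map⁺ ∷-injectiveʳ (vertices-unique n)) disjoint
  where
  disjoint : ∀ {y} → ¬ (y ∈ₗ map (false ∷_) (vertices n) × y ∈ₗ map (true ∷_) (vertices n))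
  disjoint (p , q) with ∈-map⁻ _ p | ∈-map⁻ _ q
  ... | _ , _ , refl | _ , _ , ()

sum-vertices : (f : Vec 𝔽₂ n → ℕ) → sum (map f (vertices n)) ≡ ∑ f
sum-vertices {zero}  f = +-identityʳ (f [])
sum-vertices {suc n} f = begin
  sum (map f (map (false ∷_) vs ++ map (true ∷_) vs))
    ≡⟨ cong sum (map-++ f (map (false ∷_) vs) _) ⟩
  sum (map f (map (false ∷_) vs) ++ map f (map (true ∷_) vs))
    ≡⟨ sum-++ (map f (map (false ∷_) vs)) _ ⟩
  sum (map f (map (false ∷_) vs)) + sum (map f (map (true ∷_) vs))
    ≡⟨ cong₂ _+_ (half false) (half true) ⟩
  ∑ f ∎
  where
  open ≡-Reasoning
  vs = vertices n
  half : ∀ b → sum (map f (map (b ∷_) vs)) ≡ ∑ (f ∘ (b ∷_))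
  half b = trans (cong sum (sym (map-∘ vs))) (sum-vertices (f ∘ (b ∷_)))

sum-filter : {A : Set} {P : Pred A 0ℓ} (P? : Decidable P) (f : A → ℕ) (ys : List A) →
  sum (map f (filter P? ys)) ≡ sum (map (λ y → 𝟙 (P? y) * f y) ys)
sum-filter P? f []       = refl
sum-filter P? f (y ∷ ys) with does (P? y)
... | true  = cong₂ _+_ (sym (+-identityʳ (f y))) (sum-filter P? f ys)
... | false = sum-filter P? f ys

-- Membership in `P` becomes a 0/1 weight, so everything after this handles sums by recursion on
-- coordinates instead of lists.
isSumOver : {P : Pred (Vec 𝔽₂ n) 0ℓ} (P? : Decidable P) (f : Vec 𝔽₂ n → ℕ) →
  IsSumOver P f (∑ (λ y → 𝟙 (P? y) * f y))
isSumOver {n} P? f =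
    filter P? (vertices n)
  , filter⁺ P? (vertices-unique n)
  , (λ y → mk⇔ (λ y∈ → proj₂ (∈-filter⁻ P? {xs = vertices n} y∈)) (∈-filter⁺ P? (∈-vertices y)))
  , trans (sum-filter P? f (vertices n)) (sum-vertices (λ y → 𝟙 (P? y) * f y))

-- Hamming distance

hamming : Vec 𝔽₂ n → Vec 𝔽₂ n → ℕ
hamming []      []      = 0
hamming (a ∷ x) (b ∷ y) = bit (a xor b) + hamming x y

hamming-refl : (x : Vec 𝔽₂ n) → hamming x x ≡ 0
hamming-refl []          = refl
hamming-refl (false ∷ x) = hamming-refl x
hamming-refl (true ∷ x)  = hamming-refl x

hamming≤n : (x y : Vec 𝔽₂ n) → hamming x y ≤ n
hamming≤n []      []      = z≤n
hamming≤n (a ∷ x) (b ∷ y) with a xor b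
... | false = m≤n⇒m≤1+n (hamming≤n x y)
... | true  = s≤s (hamming≤n x y)

hamming-antipode : (x y : Vec 𝔽₂ n) → hamming x (antipode y) ≡ n ∸ hamming x y
hamming-antipode []      []      = refl
hamming-antipode {suc n} (a ∷ x) (b ∷ y)
  rewrite sym (not-distribʳ-xor a b) with a xor b
... | false = trans (cong suc (hamming-antipode x y)) (sym (+-∸-assoc 1 (hamming≤n x y)))
... | true  = hamming-antipode x y

hamming-swapAt : (i : Fin n) (x y : Vec 𝔽₂ (suc n)) →
  hamming (swapAt i x) (swapAt i y) ≡ hamming x y
hamming-swapAt zero (a ∷ b ∷ x) (c ∷ d ∷ y) = swap (bit (b xor d)) (bit (a xor c)) (hamming x y)
  where
  open +-*-Solver
  swap : ∀ k l m → k + (l + m) ≡ l + (k + m)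
  swap = solve 3 (λ k l m → k :+ (l :+ m) := l :+ (k :+ m)) refl
hamming-swapAt (suc i) (a ∷ x) (b ∷ y) = cong (bit (a xor b) +_) (hamming-swapAt i x y)

-- Whatever the first coordinate of `x` is, one half of the cube agrees with it and the other half
-- is one step further away. The second half needs the claim for `g ∘ suc`, hence the quantification
-- over `g`. With `g` an indicator this says that all `D`-neighbourhoods have the same size.
∑-hamming : (g : ℕ → ℕ) (x x′ : Vec 𝔽₂ n) → ∑ (g ∘ hamming x) ≡ ∑ (g ∘ hamming x′)
∑-hamming g []      []        = refl
∑-hamming g (a ∷ x) (b ∷ x′) = trans (fromOrigin a x) (trans same (sym (fromOrigin b x′)))
  where
  fromOrigin : ∀ {n} a (x : Vec 𝔽₂ n) →
    ∑ (g ∘ hamming (a ∷ x)) ≡ ∑ (g ∘ hamming x) + ∑ (g ∘ suc ∘ hamming x)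
  fromOrigin false x = refl
  fromOrigin true  x = +-comm (∑ (g ∘ suc ∘ hamming x)) _
  same = cong₂ _+_ (∑-hamming g x x′) (∑-hamming (g ∘ suc) x x′)

-- Hamming distance as graph distance

Adj-∷ : ∀ a {x y : Vec 𝔽₂ n} → DifferInExactlyOne x y → DifferInExactlyOne (a ∷ x) (a ∷ y)
Adj-∷ a {x} {y} (i , x≢y , unique) = suc i , x≢y , λ {j} → unique′ j
  where
  unique′ : ∀ j → lookup (a ∷ x) j ≢ lookup (a ∷ y) j → suc i ≡ j
  unique′ zero    a≢a  = contradiction refl a≢a
  unique′ (suc j) x≢y′ = cong suc (unique x≢y′)

Adj-head : ∀ {a b} (x : Vec 𝔽₂ n) → a ≢ b → DifferInExactlyOne (a ∷ x) (b ∷ x)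
Adj-head {a = a} {b} x a≢b = zero , a≢b , λ {j} → unique j
  where
  unique : ∀ j → lookup (a ∷ x) j ≢ lookup (b ∷ x) j → zero ≡ j
  unique zero    _   = refl
  unique (suc j) x≢x = contradiction refl x≢x

Walk-∷ : ∀ a {x y : Vec 𝔽₂ n} {ℓ} → Walk (hypercube n) x y ℓ →
  Walk (hypercube (suc n)) (a ∷ x) (a ∷ y) ℓ
Walk-∷ a stop            = stop
Walk-∷ a (step adj walk) = step (Adj-∷ a adj) (Walk-∷ a walk)

hammingWalk : (x y : Vec 𝔽₂ n) → Walk (hypercube n) x y (hamming x y)
hammingWalk []          []          = stop
hammingWalk (false ∷ x) (false ∷ y) = Walk-∷ false (hammingWalk x y)
hammingWalk (false ∷ x) (true ∷ y)  = step (Adj-head x λ ()) (Walk-∷ true (hammingWalk x y))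
hammingWalk (true ∷ x)  (false ∷ y) = step (Adj-head x λ ()) (Walk-∷ false (hammingWalk x y))
hammingWalk (true ∷ x)  (true ∷ y)  = Walk-∷ true (hammingWalk x y)

lookup-ext : (x y : Vec 𝔽₂ n) → (∀ i → lookup x i ≡ lookup y i) → x ≡ y
lookup-ext []      []      eq = refl
lookup-ext (a ∷ x) (b ∷ y) eq = cong₂ _∷_ (eq zero) (lookup-ext x y (eq ∘ suc))

hamming-Adj : (x z y : Vec 𝔽₂ n) → DifferInExactlyOne x z → hamming x y ≤ suc (hamming z y)
hamming-Adj (a ∷ x) (c ∷ z) (b ∷ y) (zero , _ , unique)
  -- The edge is used up by the head, so the tails agree; only the head's contribution, at most 1,
  -- can change.
  rewrite lookup-ext x z (λ i → decidable-stable (_ ≟ᵇ _) λ x≢z → contradiction (unique {suc i} x≢z) 0≢1+n)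
  with a xor b
... | false = m≤n⇒m≤1+n (m≤n+m _ _)
... | true  = s≤s (m≤n+m _ _)
hamming-Adj (a ∷ x) (c ∷ z) (b ∷ y) (suc i , x≢z , unique)
  -- The edge lies in the tail, so the heads agree and contribute equally to both distances.
  rewrite decidable-stable (a ≟ᵇ c) (λ a≢c → contradiction (sym (unique {zero} a≢c)) 0≢1+n)
  with c xor b
... | false = hamming-Adj x z y (i , x≢z , sucᶠ-injective ∘ unique)
... | true  = s≤s (hamming-Adj x z y (i , x≢z , sucᶠ-injective ∘ unique))

hamming-minimal : ∀ (x y : Vec 𝔽₂ n) ℓ → Walk (hypercube n) x y ℓ → hamming x y ≤ ℓ
hamming-minimal x .x zero    stop                     = ≤-reflexive (hamming-refl x)
hamming-minimal x y  (suc ℓ) (step {y = z} adj walk) =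
  ≤-trans (hamming-Adj x z y adj) (s≤s (hamming-minimal z y ℓ walk))

neighbourhood? : {D : Pred ℕ 0ℓ} → Decidable D → (x : Vec 𝔽₂ n) →
  Decidable (Neighbourhood (hypercube n) D x)
neighbourhood? D? x y = map′ to from (D? (hamming x y))
  where
  to   = λ d∈D → hamming x y , (hammingWalk x y , hamming-minimal x y) , d∈D
  from = λ { (d , (walk , minimal) , d∈D) →
    -- Both `d` and the Hamming distance are lengths of shortest walks, so each bounds the other.
    subst _ (≤-antisym (minimal _ (hammingWalk x y)) (hamming-minimal x y d walk)) d∈D }

-- Balanced Boolean functions

-- This is the vanishing of the signed sum of w(y)(-1)^φ(y), with the two signs on opposite sides to
-- stay within ℕ.
Balanced : (Vec 𝔽₂ n → ℕ) → (Vec 𝔽₂ n → Bool) → Set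
Balanced w φ = ∑ (λ y → w y * bit (φ y)) ≡ ∑ (λ y → w y * bit (not (φ y)))

balanced-cong : (w w′ : Vec 𝔽₂ n → ℕ) (φ : Vec 𝔽₂ n → Bool) →
  w ≗ w′ → Balanced w φ → Balanced w′ φ
balanced-cong w w′ φ w≗w′ bal = trans (∑-cong λ y → cong (_* bit (φ y)) (sym (w≗w′ y)))
  (trans bal (∑-cong λ y → cong (_* bit (not (φ y))) (w≗w′ y)))

balanced-+ : (w w′ : Vec 𝔽₂ n → ℕ) (φ : Vec 𝔽₂ n → Bool) →
  Balanced w φ → Balanced w′ φ → Balanced (λ y → w y + w′ y) φ
balanced-+ w w′ φ bal bal′ =
  trans (split (bit ∘ φ)) (trans (cong₂ _+_ bal bal′) (sym (split (bit ∘ not ∘ φ))))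
  where
  split : ∀ f → ∑ (λ y → (w y + w′ y) * f y) ≡ ∑ (λ y → w y * f y) + ∑ (λ y → w′ y * f y)
  split f = trans (∑-cong λ y → *-distribʳ-+ (f y) (w y) (w′ y)) (∑-+ (λ y → w y * f y) (λ y → w′ y * f y))

balanced-not : (w : Vec 𝔽₂ n → ℕ) (φ : Vec 𝔽₂ n → Bool) → Balanced w φ → Balanced w (not ∘ φ)
balanced-not w φ bal =
  trans (sym bal) (∑-cong λ y → cong (λ b → w y * bit b) (sym (not-involutive (φ y))))

balanced⇒half : (w : Vec 𝔽₂ n → ℕ) (φ : Vec 𝔽₂ n → Bool) → Balanced w φ →
  2 * ∑ (λ y → w y * bit (φ y)) ≡ ∑ w
balanced⇒half w φ bal = begin
  2 * S                                       ≡⟨ cong (S +_) (+-identityʳ S) ⟩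
  S + S                                       ≡⟨ cong (S +_) bal ⟩
  S + ∑ (λ y → w y * bit (not (φ y)))        ≡⟨ ∑-+ (λ y → w y * bit (φ y)) (λ y → w y * bit (not (φ y))) ⟨
  ∑ (λ y → w y * bit (φ y) + w y * bit (not (φ y)))
    ≡⟨ ∑-cong (λ y → trans (sym (*-distribˡ-+ (w y) _ _))
        (trans (cong (w y *_) (bit-not (φ y))) (*-identityʳ (w y)))) ⟩
  ∑ w ∎
  where
  open ≡-Reasoning
  S = ∑ (λ y → w y * bit (φ y))

-- Coordinates are numbered from 0.
evenParity oddParity : Vec 𝔽₂ n → Bool
evenParity []      = false
evenParity (a ∷ v) = a xor oddParity v
oddParity  []      = false
oddParity  (a ∷ v) = evenParity v

-- The factor 2 stands on the right so that `suc i * 2` computes to `2 + i * 2`; the condition then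
-- passes to `g ∘ (2 +_)` by a mere shift of `i`.
PairConstant : (ℕ → ℕ) → Set
PairConstant g = ∀ i → g (i * 2) ≡ g (suc (i * 2))

-- Among the first two coordinates, the choices that differ from x in exactly
-- one place cancel each other; the other two are handled by induction.
evenParity-balanced-pairs : ∀ p (g : ℕ → ℕ) → PairConstant g → (x : Vec 𝔽₂ (suc (p * 2))) →
  Balanced (g ∘ hamming x) evenParity
evenParity-balanced-pairs zero g pc (false ∷ [])
  rewrite pc 0 = +-comm (g 1 * 0) _
evenParity-balanced-pairs zero g pc (true ∷ [])
  rewrite pc 0 = +-comm (g 1 * 0) _
evenParity-balanced-pairs (suc p) g pc (a ∷ b ∷ x) = go a b
  where
  same : Balanced (g ∘ hamming x) evenParity
  same = evenParity-balanced-pairs p g pc x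
  opposite : Balanced (g ∘ (2 +_) ∘ hamming x) evenParity
  opposite = evenParity-balanced-pairs p (g ∘ (2 +_)) (λ i → pc (suc i)) x
  cancel : ∑ (λ y → g (suc (hamming x y)) * bit (evenParity y)) ≡
           ∑ (λ y → g (suc (hamming x y)) * bit (not (not (evenParity y))))
  cancel = ∑-cong λ y → cong (λ c → g (suc (hamming x y)) * bit c) (sym (not-involutive (evenParity y)))
  crossed : ℕ
  crossed = ∑ (λ y → g (suc (hamming x y)) * bit (not (evenParity y)))
  -- Subscripts are the first two coordinates of the summation vertex. For a = b the one-place
  -- changes are 01 and 10, which `outer` matches crosswise; for a ≠ b they are 00 and 11, matched
  -- crosswise by `inner`.
  outer : ∀ {k₀₀ k₀₁ k₁₀ k₁₁ l₀₀ l₀₁ l₁₀ l₁₁ : ℕ} → k₀₀ ≡ l₀₀ → k₁₁ ≡ l₁₁ → k₀₁ ≡ l₁₀ → k₁₀ ≡ l₀₁ →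
    (k₀₀ + k₀₁) + (k₁₀ + k₁₁) ≡ (l₀₀ + l₀₁) + (l₁₀ + l₁₁)
  outer {k₀₀} {k₀₁} {k₁₀} {k₁₁} refl refl refl refl =
    interchange +-commutativeSemigroup k₀₀ k₀₁ k₁₀ k₁₁
  inner : ∀ {k₀₀ k₀₁ k₁₀ k₁₁ l₀₀ l₀₁ l₁₀ l₁₁ : ℕ} → k₀₁ ≡ l₀₁ → k₁₀ ≡ l₁₀ → k₀₀ ≡ l₁₁ → k₁₁ ≡ l₀₀ →
    (k₀₀ + k₀₁) + (k₁₀ + k₁₁) ≡ (l₀₀ + l₀₁) + (l₁₀ + l₁₁)
  inner {k₀₀} {k₀₁} {k₁₀} {k₁₁} refl refl refl refl =
    solve 4 (λ a b c d → (a :+ b) :+ (c :+ d) := (d :+ b) :+ (c :+ a)) refl k₀₀ k₀₁ k₁₀ k₁₁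
    where open +-*-Solver
  same′ : Balanced (g ∘ hamming x) (not ∘ evenParity)
  same′ = balanced-not (g ∘ hamming x) evenParity same
  opposite′ : Balanced (g ∘ (2 +_) ∘ hamming x) (not ∘ evenParity)
  opposite′ = balanced-not (g ∘ (2 +_) ∘ hamming x) evenParity opposite
  go : ∀ a b → Balanced (g ∘ hamming (a ∷ b ∷ x)) evenParity
  go false false = outer same opposite′ cancel refl
  go false true  = inner {k₁₁ = crossed} same opposite′ cancel refl
  go true  false = inner {k₁₁ = crossed} opposite same′ cancel refl
  go true  true  = outer opposite same′ cancel refl

-- Each block of four coordinates holds two terms of the form, whose complements cancel; the one
-- remaining coordinate flips the value. This uses n ≡ 1 modulo 4, and writing `q * 2 * 2` lets
-- `suc q` expose such a block by computation.
evenParity-antipode : ∀ q (y : Vec 𝔽₂ (suc (q * 2 * 2))) →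
  evenParity (antipode y) ≡ not (evenParity y)
evenParity-antipode zero    (false ∷ []) = refl
evenParity-antipode zero    (true ∷ [])  = refl
evenParity-antipode (suc q) (a ∷ _ ∷ c ∷ _ ∷ y) rewrite evenParity-antipode q y = cases a c (evenParity y)
  where
  cases : ∀ a c e → not a xor (not c xor not e) ≡ not (a xor (c xor e))
  cases a c e = begin
    not a xor (not c xor not e) ≡⟨ cong (not a xor_) (xor-annihilates-not c e) ⟩
    not a xor (c xor e)         ≡⟨ not-distribˡ-xor a (c xor e) ⟨
    not (a xor (c xor e))       ∎
    where
    open ≡-Reasoning

-- The substitution of `antipode y` for `y` keeps the weights, by the symmetry of `h`, and negates
-- the form, so it exchanges the two sides.
evenParity-balanced-antipodal : ∀ q (h : ℕ → ℕ) → let n = suc (q * 2 * 2) in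
  (∀ d → d ≤ n → h (n ∸ d) ≡ h d) → (x : Vec 𝔽₂ n) → Balanced (h ∘ hamming x) evenParity
evenParity-balanced-antipodal q h symmetric x =
  trans (sym (∑-antipode (λ y → h (hamming x y) * bit (evenParity y)))) (∑-cong λ y →
    cong₂ (λ k b → k * bit b)
      (trans (cong h (hamming-antipode x y)) (symmetric _ (hamming≤n x y)))
      (evenParity-antipode q y))

-- Exchanging coordinates is an isometry, so a change of variables moves the centre from `x` to
-- `swapAt i x`; this is why balance is assumed around every centre.
balanced-swapAt : (g : ℕ → ℕ) (φ : Vec 𝔽₂ (suc n) → Bool) →
  (∀ x → Balanced (g ∘ hamming x) φ) →
  ∀ i x → Balanced (g ∘ hamming x) (φ ∘ swapAt i)
balanced-swapAt g φ bal i x =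
  trans (transport (bit ∘ φ)) (trans (bal (swapAt i x)) (sym (transport (bit ∘ not ∘ φ))))
  where
  transport : ∀ f → ∑ (λ y → g (hamming x y) * f (swapAt i y)) ≡
                    ∑ (λ y → g (hamming (swapAt i x) y) * f y)
  transport f = trans
    (∑-cong λ y → cong (λ d → g d * f (swapAt i y)) (sym (hamming-swapAt i x y)))
    (∑-swapAt i (λ y → g (hamming (swapAt i x) y) * f y))

-- The labelling

digits : Vec 𝔽₂ (suc n) → Vec 𝔽₂ (suc n)
digits y = evenParity y ∷ tabulate (λ i → evenParity (swapAt i y))

difference : Fin n → Vec 𝔽₂ (suc n) → Bool
difference zero    (a ∷ b ∷ _) = a xor b
difference (suc i) (_ ∷ v)     = difference i v

xor-exchange : ∀ a b p → b xor p ≡ (a xor p) xor (a xor b)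
xor-exchange false false false = refl
xor-exchange false false true  = refl
xor-exchange false true  false = refl
xor-exchange false true  true  = refl
xor-exchange true  false false = refl
xor-exchange true  false true  = refl
xor-exchange true  true  false = refl
xor-exchange true  true  true  = refl

-- Of two neighbouring coordinates exactly one is a term of the form, and the exchange replaces it
-- by the other. The two statements need each other because dropping the head exchanges the
-- parities.
evenParity-swapAt : (i : Fin n) (v : Vec 𝔽₂ (suc n)) →
  evenParity (swapAt i v) ≡ evenParity v xor difference i v
oddParity-swapAt : (i : Fin n) (v : Vec 𝔽₂ (suc n)) →
  oddParity (swapAt i v) ≡ oddParity v xor difference i v
evenParity-swapAt zero    (a ∷ b ∷ v) = xor-exchange a b (evenParity v)
evenParity-swapAt (suc i) (a ∷ v)     =
  trans (cong (a xor_) (oddParity-swapAt i v)) (sym (xor-assoc a _ _))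
oddParity-swapAt zero    (a ∷ b ∷ v) = trans (xor-exchange b a (oddParity v))
  (cong ((b xor oddParity v) xor_) (xor-comm b a))
oddParity-swapAt (suc i) (a ∷ v)     = evenParity-swapAt i v

xor-cancelˡ : ∀ a {b c} → a xor b ≡ a xor c → b ≡ c
xor-cancelˡ false eq = eq
xor-cancelˡ true  eq = not-injective eq

-- Once the last coordinate is chosen, each difference fixes the coordinate before it; the two
-- choices yield antipodal vectors.
differences-determine : (x y : Vec 𝔽₂ (suc n)) → (∀ i → difference i x ≡ difference i y) →
  x ≡ y ⊎ x ≡ antipode y
differences-determine (false ∷ []) (false ∷ []) eq = inj₁ refl
differences-determine (false ∷ []) (true ∷ [])  eq = inj₂ refl
differences-determine (true ∷ [])  (false ∷ []) eq = inj₂ refl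
differences-determine (true ∷ [])  (true ∷ [])  eq = inj₁ refl
differences-determine (a ∷ a′ ∷ x) (b ∷ b′ ∷ y) eq
  with differences-determine (a′ ∷ x) (b′ ∷ y) (eq ∘ suc)
... | inj₁ refl = inj₁ (cong (_∷ a′ ∷ x) (xor-cancelʳ a b a′ (eq zero)))
  where
  xor-cancelʳ : ∀ a b c → a xor c ≡ b xor c → a ≡ b
  xor-cancelʳ a b c eq = xor-cancelˡ c (trans (xor-comm c a) (trans eq (xor-comm b c)))
... | inj₂ refl = inj₂ (cong (_∷ not b′ ∷ antipode y) (opposite a b b′ (eq zero)))
  where
  opposite : ∀ a b c → a xor not c ≡ b xor c → a ≡ not b
  opposite false false false ()
  opposite false false true  ()
  opposite false true  _     _ = refl
  opposite true  false _     _ = refl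
  opposite true  true  false ()
  opposite true  true  true  ()

-- This is the linear independence of the forms. Adding the first digit to the others recovers all
-- neighbouring differences, hence the vector up to antipode, and the first digit itself tells
-- antipodes apart.
digits-injective : ∀ q → Injective _≡_ _≡_ (digits {q * 2 * 2})
digits-injective q {x} {y} eq with differences-determine x y differences≡
  where
  even≡ : evenParity x ≡ evenParity y
  even≡ = ∷-injectiveˡ eq
  swapped≡ : ∀ i → evenParity (swapAt i x) ≡ evenParity (swapAt i y)
  swapped≡ i = trans (sym (lookup∘tabulate _ i))
    (trans (cong (λ v → lookup v i) (∷-injectiveʳ eq)) (lookup∘tabulate _ i))
  differences≡ : ∀ i → difference i x ≡ difference i y
  differences≡ i = xor-cancelˡ (evenParity x) (begin
    evenParity x xor difference i x ≡⟨ evenParity-swapAt i x ⟨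
    evenParity (swapAt i x)         ≡⟨ swapped≡ i ⟩
    evenParity (swapAt i y)         ≡⟨ evenParity-swapAt i y ⟩
    evenParity y xor difference i y ≡⟨ cong (_xor _) even≡ ⟨
    evenParity x xor difference i y ∎)
    where open ≡-Reasoning
... | inj₁ x≡y  = x≡y
... | inj₂ refl = contradiction (evenParity-antipode q y) (not-¬ (∷-injectiveˡ eq))

-- Injective self-maps of finite sets

endo-injective⇒surjective : (f : Fin n → Fin n) → Injective _≡_ _≡_ f → ∀ j → ∃[ i ] f i ≡ j
endo-injective⇒surjective {suc n} f inj j with any? (λ i → f i ≟ᶠ j)
... | yes hit = hit
-- A missed value could be removed from the codomain, leaving an injection into a smaller set.
... | no miss = contradiction (injective⇒≤ avoid-injective) 1+n≰n
  where
  j≢f : ∀ i → j ≢ f i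
  j≢f i j≡fi = miss (i , sym j≡fi)
  avoid : Fin (suc n) → Fin n
  avoid i = punchOut (j≢f i)
  avoid-injective : Injective _≡_ _≡_ avoid
  avoid-injective eq = inj (punchOut-injective (j≢f _) (j≢f _) eq)

finite-injective⇒bijection : {A : Set} {N : ℕ} → A ↔ Fin N → (f : A → A) → Injective _≡_ _≡_ f → A ⤖ A
finite-injective⇒bijection A↔Fin f inj = mk⤖ (inj , surjective)
  where
  open Inverse A↔Fin
  surjective : Surjective _≡_ _≡_ f
  surjective b with endo-injective⇒surjective (to ∘ f ∘ from)
                      (λ eq → from-injective (inj (to-injective eq))) (to b)
    where
    to-injective : Injective _≡_ _≡_ to
    to-injective {x} {y} eq = trans (sym (strictlyInverseʳ x)) (trans (cong from eq) (strictlyInverseʳ y))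
    from-injective : Injective _≡_ _≡_ from
    from-injective {i} {j} eq = trans (sym (strictlyInverseˡ i)) (trans (cong to eq) (strictlyInverseˡ j))
  ... | i , eq = from i , λ where
    refl → trans (sym (strictlyInverseʳ _)) (trans (cong from eq) (strictlyInverseʳ b))

labelling : ∀ q → let n = suc (q * 2 * 2) in Vec 𝔽₂ n ⤖ Fin (2 ^ n)
labelling q = ↔⇒⤖ (𝔽₂^↔Fin _) ⤖-∘ finite-injective⇒bijection (𝔽₂^↔Fin _) digits (digits-injective q)

-- Weighted sums of binary numbers

value : Vec 𝔽₂ n → ℕ
value {n} v = toℕ (Inverse.to (𝔽₂^↔Fin n) v)

value-∷ : ∀ b (v : Vec 𝔽₂ n) → value (b ∷ v) ≡ 2 ^ n * bit b + value v
value-∷ {n} false v = toℕ-combine {2} {2 ^ n} zero (Inverse.to (𝔽₂^↔Fin n) v)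
value-∷ {n} true  v = toℕ-combine {2} {2 ^ n} (suc zero) (Inverse.to (𝔽₂^↔Fin n) v)

-- Each balanced digit contributes half its place value, so the mean label is 1 + (2^n - 1)/2; the
-- factor 2 avoids halves. The number of digits is kept apart from the dimension `m`, since the
-- induction removes digits while the sum stays over the same cube.
∑-value : ∀ {m} (w : Vec 𝔽₂ m → ℕ) (F : Vec 𝔽₂ m → Vec 𝔽₂ n) →
  (∀ i → Balanced w (λ y → lookup (F y) i)) →
  2 * ∑ (λ y → w y * suc (value (F y))) ≡ suc (2 ^ n) * ∑ w
∑-value {zero} w F bal = cong (2 *_) (∑-cong λ y → lemma (w y) (F y))
  where
  lemma : ∀ k (v : Vec 𝔽₂ 0) → k * suc (value v) ≡ k
  lemma k [] = *-identityʳ k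
∑-value {suc n} w F bal = begin
  2 * ∑ (λ y → w y * suc (value (F y)))
    ≡⟨ cong (2 *_) (∑-cong λ y → split (w y) (F y)) ⟩
  2 * ∑ (λ y → 2 ^ n * leadTerm y + restTerm y)
    ≡⟨ cong (2 *_) (trans (∑-+ (λ y → 2 ^ n * leadTerm y) restTerm) (cong (_+ rest) (∑-*ˡ (2 ^ n) leadTerm))) ⟩
  2 * (2 ^ n * lead + rest)
    ≡⟨ regroup (2 ^ n) lead rest ⟩
  2 ^ n * (2 * lead) + 2 * rest
    ≡⟨ cong₂ (λ k l → 2 ^ n * k + l) (balanced⇒half w _ (bal zero))
         (∑-value w (Vec.tail ∘ F) tail-bal) ⟩
  2 ^ n * ∑ w + suc (2 ^ n) * ∑ w
    ≡⟨ collect (2 ^ n) (∑ w) ⟩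
  suc (2 ^ suc n) * ∑ w ∎
  where
  open ≡-Reasoning
  open +-*-Solver
  leadTerm = λ y → w y * bit (lookup (F y) zero)
  restTerm = λ y → w y * suc (value (Vec.tail (F y)))
  lead = ∑ leadTerm
  rest = ∑ restTerm
  regroup : ∀ e k l → 2 * (e * k + l) ≡ e * (2 * k) + 2 * l
  regroup = solve 3 (λ e k l → con 2 :* (e :* k :+ l) := e :* (con 2 :* k) :+ con 2 :* l) refl
  collect : ∀ e k → e * k + suc e * k ≡ suc (2 * e) * k
  collect = solve 2 (λ e k → e :* k :+ (con 1 :+ e) :* k := (con 1 :+ con 2 :* e) :* k) refl
  expand : ∀ k e b l → k * suc (e * b + l) ≡ e * (k * b) + k * suc l
  expand = solve 4 (λ k e b l → k :* (con 1 :+ (e :* b :+ l)) := e :* (k :* b) :+ k :* (con 1 :+ l)) refl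
  split : ∀ k (v : Vec 𝔽₂ (suc n)) →
    k * suc (value v) ≡ 2 ^ n * (k * bit (lookup v zero)) + k * suc (value (Vec.tail v))
  split k (b ∷ v) = trans (cong (λ l → k * suc l) (value-∷ b v)) (expand k (2 ^ n) (bit b) (value v))
  lookup-tail : ∀ (v : Vec 𝔽₂ (suc n)) i → lookup v (suc i) ≡ lookup (Vec.tail v) i
  lookup-tail (_ ∷ _) i = refl
  tail-bal : ∀ i → Balanced w (λ y → lookup (Vec.tail (F y)) i)
  tail-bal i = trans (∑-cong λ y → cong (λ b → w y * bit b) (sym (lookup-tail (F y) i)))
    (trans (bal (suc i)) (∑-cong λ y → cong (λ b → w y * bit (not b)) (lookup-tail (F y) i)))

-- Magic labelling for a distance set split into two parts

module _ (q : ℕ) {D₁ D₂ : Pred ℕ 0ℓ} (D₁? : Decidable D₁) (D₂? : Decidable D₂)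
  (disjoint : ∀ {d} → D₁ d → ¬ D₂ d)
  (paired : ∀ i → D₁ (i * 2) ⇔ D₁ (suc (i * 2)))
  (symmetric : ∀ {d} → d ≤ suc (q * 2 * 2) → D₂ d → D₂ (suc (q * 2 * 2) ∸ d))
  where

  private
    N : ℕ
    N = suc (q * 2 * 2)

    D? : Decidable (D₁ ∪ D₂)
    D? d = D₁? d ⊎-dec D₂? d

    weight : ℕ → ℕ
    weight d = 𝟙 (D? d)

    evenParity-balanced : (x : Vec 𝔽₂ N) → Balanced (weight ∘ hamming x) evenParity
    evenParity-balanced x = balanced-cong (λ y → w₁ y + w₂ y) (weight ∘ hamming x) evenParity
      -- Disjointness lets no distance count twice, so the weight is the sum of two separately
      -- balanced weights.
      (λ y → sym (𝟙-⊎ (D₁? (hamming x y)) (D₂? (hamming x y)) disjoint))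
      (balanced-+ w₁ w₂ evenParity
        (evenParity-balanced-pairs (q * 2) (λ d → 𝟙 (D₁? d))
          (λ i → 𝟙-cong (D₁? (i * 2)) (D₁? (suc (i * 2))) (paired i)) x)
        (evenParity-balanced-antipodal q (λ d → 𝟙 (D₂? d))
          (λ d d≤N → 𝟙-cong (D₂? (N ∸ d)) (D₂? d) (mk⇔ (back d≤N) (symmetric d≤N))) x))
      where
      w₁ w₂ : Vec 𝔽₂ N → ℕ
      w₁ y = 𝟙 (D₁? (hamming x y))
      w₂ y = 𝟙 (D₂? (hamming x y))
      back : ∀ {d} → d ≤ N → D₂ (N ∸ d) → D₂ d
      -- Complementation is an involution on distances up to `N`, so closure in one direction gives
      -- the converse.
      back {d} d≤N N∸d∈D₂ = subst D₂ (m∸[m∸n]≡n d≤N) (symmetric (m∸n≤m N d) N∸d∈D₂)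

    digits-balanced : (x : Vec 𝔽₂ N) (i : Fin N) → Balanced (weight ∘ hamming x) (λ y → lookup (digits y) i)
    digits-balanced x zero    = evenParity-balanced x
    digits-balanced x (suc i) =
      trans (∑-cong λ y → cong (λ b → weight (hamming x y) * bit b) (digit y))
        (trans (balanced-swapAt weight evenParity evenParity-balanced i x)
          (∑-cong λ y → cong (λ b → weight (hamming x y) * bit (not b)) (sym (digit y))))
      where
      digit : ∀ y → lookup (digits y) (suc i) ≡ evenParity (swapAt i y)
      digit y = lookup∘tabulate _ i

    labelSum : Vec 𝔽₂ N → ℕ
    labelSum x = ∑ (λ y → weight (hamming x y) * suc (value (digits y)))

    -- Twice the sum is 2^N + 1 times the size of the neighbourhood, and that size does not depend
    -- on the centre.
    labelSum-constant : ∀ x x′ → labelSum x ≡ labelSum x′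
    labelSum-constant x x′ = *-cancelˡ-≡ _ _ 2 (begin
      2 * labelSum x                              ≡⟨ ∑-value (weight ∘ hamming x) digits (digits-balanced x) ⟩
      suc (2 ^ N) * ∑ (weight ∘ hamming x)        ≡⟨ cong (suc (2 ^ N) *_) (∑-hamming weight x x′) ⟩
      suc (2 ^ N) * ∑ (weight ∘ hamming x′)       ≡⟨ ∑-value (weight ∘ hamming x′) digits (digits-balanced x′) ⟨
      2 * labelSum x′                             ∎)
      where open ≡-Reasoning

  labelling-magic : IsMagicLabeling (hypercube N) (D₁ ∪ D₂) (labelling q)
  -- The magic constant is read off at the zero vector. `label` unfolds to `suc (value (digits y))`
  -- and `neighbourhood?` computes to `D?` at the Hamming distance, so the sum supplied by
  -- `isSumOver` is `labelSum x` by computation.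
  labelling-magic = labelSum (replicate N false) , λ x →
    subst (IsSumOver _ _) (labelSum-constant x (replicate N false))
      (isSumOver (neighbourhood? D? x) (label (hypercube N) (labelling q)))

-- From index sets to a split distance set

theorem3p9 : (n : ℕ) → n % 4 ≡ 1 →
    (I₁ I₂ : IndexSet n) →
    (∀ i j → i ∈ I₁ → j ∈ I₂ →
    Empty (consecutivePair (toℕ i) ∩ complementaryPair n (toℕ j))) →
    AdmitsMagicLabeling (hypercube n) (distanceSet n I₁ I₂)
theorem3p9 n n%4≡1 = go (n / 4) n n≡
  where
  n≡ : n ≡ suc (n / 4 * 2 * 2)
  n≡ = trans (m≡m%n+[m/n]*n n 4) (cong₂ _+_ n%4≡1 (sym (*-assoc (n / 4) 2 2)))
  -- Here `q` is independent of `n`, so the equation can be matched with `refl`, which would fail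
  -- with `n / 4` in its place.
  go : ∀ q n → n ≡ suc (q * 2 * 2) → (I₁ I₂ : IndexSet n) →
    (∀ i j → i ∈ I₁ → j ∈ I₂ →
    Empty (consecutivePair (toℕ i) ∩ complementaryPair n (toℕ j))) →
    AdmitsMagicLabeling (hypercube n) (distanceSet n I₁ I₂)
  go q n refl I₁ I₂ empty = labelling q , labelling-magic q D₁? D₂?
    (λ { (i , i∈I₁ , d∈) (j , j∈I₂ , d∈′) → empty i j i∈I₁ j∈I₂ _ (d∈ , d∈′) })
    (λ i → mk⇔ (up i) (down i))
    symmetric
    where
    D₁ D₂ : Pred ℕ 0ℓ
    D₁ d = ∃[ i ] (i ∈ I₁ × consecutivePair (toℕ i) d)
    D₂ d = ∃[ j ] (j ∈ I₂ × complementaryPair n (toℕ j) d)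
    D₁? : Decidable D₁
    D₁? d = any? λ i → (i ∈? I₁) ×-dec ((2 * toℕ i ≟ d) ⊎-dec (2 * toℕ i + 1 ≟ d))
    D₂? : Decidable D₂
    D₂? d = any? λ j → (j ∈? I₂) ×-dec ((toℕ j ≟ d) ⊎-dec (n ∸ toℕ j ≟ d))
    up : ∀ i → D₁ (i * 2) → D₁ (suc (i * 2))
    up i (k , k∈I₁ , inj₁ eq) = k , k∈I₁ , inj₂ (trans (+-comm _ 1) (cong suc eq))
    -- The even number `i * 2` would equal the odd member of a pair.
    up i (k , k∈I₁ , inj₂ eq) = contradiction
      (trans (*-comm 2 i) (trans (sym eq) (+-comm _ 1))) (even≢odd i (toℕ k))
    down : ∀ i → D₁ (suc (i * 2)) → D₁ (i * 2)
    down i (k , k∈I₁ , inj₁ eq) = contradiction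
      (trans eq (cong suc (*-comm i 2))) (even≢odd (toℕ k) i)
    down i (k , k∈I₁ , inj₂ eq) = k , k∈I₁ , inj₁ (suc-injective (trans (+-comm 1 _) eq))
    symmetric : ∀ {d} → d ≤ n → D₂ d → D₂ (n ∸ d)
    symmetric d≤n (j , j∈I₂ , inj₁ refl) = j , j∈I₂ , inj₂ refl
    -- Since `∸` truncates, undoing the complement requires j ≤ n, which follows from j ≤ (n - 1)/2.
    symmetric d≤n (j , j∈I₂ , inj₂ refl) = j , j∈I₂ , inj₁ (sym (m∸[m∸n]≡n j≤n))
      where
      j≤n : toℕ j ≤ n
      j≤n = ≤-trans (toℕ≤pred[n] j) (≤-trans (m/n≤m (q * 2 * 2) 2) (n≤1+n _))
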